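{- Let $\mathcal{C}$ be a graph class that is hereditary and separable with degree $\alpha\in(0,1)$. Then every graph $G\in\mathcal{C}$, say on $n$ vertices, admits a generalized elimination forest $(F,\eta)$ satisfying: (C1) $F$ has one root and every node of $F$ has at most seven children; (C2) $(F,\eta)$ has topological height at most $1+\log_2 n$ and height $\mathcal{O}(n^\alpha)$; (C3) for every node $x$ of $F$, if $i$ is the depth of $x$ in $F$, then $|\eta^{ -1}(x)|\le\mathcal{O}((n/2^i)^\alpha)$, $|\eta^{ -1}(\mathsf{subtree}[x])|\le n/2^i$, and $|N_G(\eta^{ -1}(\mathsf{subtree}[x]))|\le\mathcal{O}((n/2^i)^\alpha)$. (The constants in the $\mathcal{O}$-notation depend only on $\mathcal{C}$.)
   Context: A graph class is hereditary if closed under taking induced subgraphs. $\mathcal{C}$ is separable with degree $\alpha$ if there is a constant $K$ such that for every $G\in\mathcal{C}$ on $n$ vertices and every $S\subseteq V(G)$ there exists $X\subseteq V(G)$ with $|X|\le Kn^\alpha$ such that every connected component of $G-X$ contains at most $|S|/2$ vertices of $S$. In a rooted forest $F$, $y\preceq x$ means $y$ is an ancestor of $x$ (including $x$ itself); $\mathsf{subtree}[x]$ is the set of descendants of $x$ including $x$; the depth (level) of $x$ is its number of strict ancestors; the height of $F$ is the maximum level plus one. A generalized elimination forest of $G$ is a pair $(F,\eta)$ with $F$ a rooted forest and $\eta\colon V(G)\to V(F)$ such that for every edge $uv\in E(G)$, $\eta(u)\preceq\eta(v)$ or $\eta(v)\preceq\eta(u)$. Its topological height is the height of $F$, and its height is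 $\max_{x\in V(F)}\sum_{y\preceq x}|\eta^{ -1}(y)|$. $N_G(Y)$ denotes the set of vertices outside $Y$ adjacent to a vertex of $Y$. -}

module Defs where

open import Data.Nat using (ℕ; zero; suc; _+_; _*_; _^_; _≤_; _<_)
open import Data.Nat.Logarithm using (⌊log₂_⌋)
open import Data.Fin using (Fin)
open import Data.Fin.Subset using (Subset; _∈_; _∉_; ∣_∣)
open import Data.Bool using (Bool; true; false)
open import Data.Maybe using (Maybe; just; nothing)
open import Data.Product using (Σ; ∃; _×_; _,_)
open import Data.Sum using (_⊎_)
open import Relation.Nullary using (¬_)
open import Relation.Binary.PropositionalEquality using (_≡_)
open import Function.Definitions using (Injective)
open import Level using (Level) renaming (suc to lsuc; zero to lzero)

-- Real exponents α ∈ (0,1), given as Dedekind (strict upper) cuts of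
-- the non-negative rationals.  A pair (p , q) stands for p / (1 + q);
-- Above p q  means  p / (1 + q) > α.

record Exponent : Set₁ where
  field
    Above     : ℕ → ℕ → Set
    up-closed : ∀ {p q p′ q′} → Above p q → p * suc q′ ≤ p′ * suc q → Above p′ q′
    rounded   : ∀ {p q} → Above p q →
                Σ ℕ λ p′ → Σ ℕ λ q′ → Above p′ q′ × p′ * suc q < p * suc q′
    below-one : Σ ℕ λ p → Σ ℕ λ q → Above p q × p < suc q
    positive  : Σ ℕ λ p → Σ ℕ λ q → 0 < p × ¬ Above p q
open Exponent public

-- x ≤ K · (num / den) ^ α   (num/den a non-negative rational, den ≥ 1).
-- Since (num/den)^r decreases to (num/den)^α as rationals r ↓ α, this holds
-- iff  x ^ q′ · den ^ p ≤ K ^ q′ · num ^ p  for every rational r = p/q′ > α.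
BoundedBy : Exponent → (K num den x : ℕ) → Set
BoundedBy α K num den x =
  ∀ p q → Above α p q → x ^ suc q * den ^ p ≤ K ^ suc q * num ^ p

record Graph (n : ℕ) : Set where
  field
    adj     : Fin n → Fin n → Bool
    adj-sym : ∀ i j → adj i j ≡ adj j i
    irrefl  : ∀ i → adj i i ≡ false
open Graph public

induced : ∀ {n k} → Graph n → (Fin k → Fin n) → Graph k
induced G f = record
  { adj     = λ i j → adj G (f i) (f j)
  ; adj-sym = λ i j → adj-sym G (f i) (f j)
  ; irrefl  = λ i → irrefl G (f i)
  }

GraphClass : Set₁
GraphClass = ∀ {n} → Graph n → Set

Hereditary : GraphClass → Set
Hereditary 𝒞 = ∀ {n k} (G : Graph n) (f : Fin k → Fin n) →
  Injective _≡_ _≡_ f → 𝒞 G → 𝒞 (induced G f)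

data Walk {n} (G : Graph n) (X : Subset n) : Fin n → Fin n → Set where
  stop : ∀ {u} → u ∉ X → Walk G X u u
  step : ∀ {u w v} → u ∉ X → adj G u w ≡ true → Walk G X w v → Walk G X u v

-- Every connected component of G - X contains at most |S|/2 vertices of S:
-- for every v ∉ X, every set T of S-vertices lying in v's component has 2|T| ≤ |S|.
BalancedSeparator : ∀ {n} → Graph n → (S X : Subset n) → Set
BalancedSeparator {n} G S X =
  ∀ (v : Fin n) → v ∉ X → ∀ (T : Subset n) →
  (∀ u → u ∈ T → u ∈ S × Walk G X v u) → 2 * ∣ T ∣ ≤ ∣ S ∣

Separable : GraphClass → Exponent → Set
Separable 𝒞 α = Σ ℕ λ K → ∀ {n} (G : Graph n) → 𝒞 G → ∀ (S : Subset n) →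
  Σ (Subset n) λ X → BoundedBy α K n 1 ∣ X ∣ × BalancedSeparator G S X

-- Rooted forests on node set Fin m, via parent pointers.  The field
-- depth (number of strict ancestors) witnesses acyclicity.

record RootedForest (m : ℕ) : Set where
  field
    parent       : Fin m → Maybe (Fin m)
    depth        : Fin m → ℕ
    depth-root   : ∀ x → parent x ≡ nothing → depth x ≡ 0
    depth-parent : ∀ x y → parent x ≡ just y → depth x ≡ suc (depth y)
open RootedForest public

data Anc {m} (F : RootedForest m) (y : Fin m) : Fin m → Set where
  anc-refl : Anc F y y
  anc-step : ∀ {x z} → parent F x ≡ just z → Anc F y z → Anc F y x

IsGenElimForest : ∀ {n m} → Graph n → RootedForest m → (Fin n → Fin m) → Set
IsGenElimForest G F η =
  ∀ u v → adj G u v ≡ true → Anc F (η u) (η v) ⊎ Anc F (η v) (η u)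

C1 : ∀ {m} → RootedForest m → Set
C1 {m} F =
  (Σ (Fin m) λ r → parent F r ≡ nothing × (∀ x → parent F x ≡ nothing → x ≡ r))
  × (∀ (x : Fin m) (T : Subset m) → (∀ y → y ∈ T → parent F y ≡ just x) → ∣ T ∣ ≤ 7)

-- (C2): topological height ≤ 1 + log₂ n (i.e. every level ≤ ⌊log₂ n⌋, as
-- levels are integers), and height ≤ K n^α (every set of vertices mapped
-- to ancestors of a single node x has size ≤ K n^α).
C2 : ∀ {n m} → Exponent → ℕ → Graph n → RootedForest m → (Fin n → Fin m) → Set
C2 {n} {m} α K G F η =
  (∀ (x : Fin m) → depth F x ≤ ⌊log₂ n ⌋)
  × (∀ (x : Fin m) (T : Subset n) → (∀ v → v ∈ T → Anc F (η v) x) →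
       BoundedBy α K n 1 ∣ T ∣)

C3 : ∀ {n m} → Exponent → ℕ → Graph n → RootedForest m → (Fin n → Fin m) → Set
C3 {n} {m} α K G F η = ∀ (x : Fin m) →
  (∀ (T : Subset n) → (∀ v → v ∈ T → η v ≡ x) →
     BoundedBy α K n (2 ^ depth F x) ∣ T ∣)
  × (∀ (T : Subset n) → (∀ v → v ∈ T → Anc F x (η v)) →
       ∣ T ∣ * 2 ^ depth F x ≤ n)
  × (∀ (T : Subset n) →
       (∀ w → w ∈ T → ¬ Anc F x (η w) ×
                      Σ (Fin n) λ v → Anc F x (η v) × adj G w v ≡ true) →
       BoundedBy α K n (2 ^ depth F x) ∣ T ∣)

{-# OPTIONS --safe #-}
module Submission where

-- At a node responsible for a vertex set W of size at most n / 2^i, apply separability inside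
-- G[W ∪ N(W)] once to halve W and once to halve N(W).  The components left by the union X of the
-- two separators can be merged into five groups, each with at most half of W and half of N(W);
-- X ∩ W is the bag and the groups, intersected with W, are the children.  If |N(W)| ≤ C (n / 2^i)^α
-- then a child's neighbourhood has size at most |X| + |N(W)| / 2, which is at most
-- C (n / 2^(i+1))^α for C large because 2^(-α) > 1/2.  Bags shrink by 2^(-α) < 1 per level, so the
-- bags on a root path sum to a geometric series.  The forest does not depend on α, hence each
-- estimate may be checked for one rational exponent p / q > α at a time; the exponents near α
-- suffice, and there 2^(1 - p/q) and 2^(p/q) are bounded away from 1 by Bernoulli's inequality.

open import Defs
open import Data.Bool using (true; if_then_else_)
import Data.Bool.Properties as Bool
open import Data.Empty using (⊥)
open import Data.Fin using (Fin; zero; suc; pinch; combine; remQuot; _↑ʳ_)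
open import Data.Fin.Patterns
import Data.Fin.Properties as Fin
open import Data.Fin.Subset using (Subset; inside; outside; _∈_; _∉_; _⊆_; ∣_∣; _∪_; _∩_; _-_; ∁; ⊤)
open import Data.Fin.Subset.Properties
open import Data.List using (List; []; _∷_; cartesianProduct; allFin)
import Data.List.Membership.Propositional as List
open import Data.List.Membership.Propositional.Properties using (∈-cartesianProduct⁺; ∈-allFin)
open import Data.List.Relation.Unary.Any using (here; there)
open import Data.Maybe as Maybe using (Maybe; just; nothing)
open import Data.Nat
open import Data.Nat.Induction using (<-wellFounded)
open import Data.Nat.Logarithm using (⌊log₂_⌋; ⌊log₂⌋-mono-≤; ⌊log₂[2^n]⌋≡n)
open import Data.Nat.Logarithm.Core using (⌊log2⌋)
open import Data.Nat.Properties
open import Data.Nat.Tactic.RingSolver using (solve-∀)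
open import Data.Product using (Σ; ∃; _×_; _,_; proj₁; proj₂)
open import Data.Sum as Sum using (_⊎_; inj₁; inj₂; [_,_]′)
open import Data.Vec using ([]; _∷_; tabulate; here; there)
open import Data.Vec.Properties using (lookup∘tabulate; []=⇒lookup; lookup⇒[]=)
open import Function using (_∘_; Injective)
open import Induction.WellFounded using (Acc; acc)
open import Relation.Binary.PropositionalEquality
open import Relation.Nullary using (¬_; yes; no; contradiction; does)
open import Relation.Nullary.Decidable using (dec-true; _×-dec_; ¬?)
open import Relation.Unary using (Decidable)

-- Powers with rational exponents

^-distribʳ-* : ∀ k m n → (m * n) ^ k ≡ m ^ k * n ^ k
^-distribʳ-* zero    m n = refl
^-distribʳ-* (suc k) m n rewrite ^-distribʳ-* k m n = lemma m n (m ^ k) (n ^ k)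
  where
  lemma : ∀ a b c d → a * b * (c * d) ≡ a * c * (b * d)
  lemma = solve-∀

^-cancelˡ-≤ : ∀ k .{{_ : NonZero k}} {m n} → m ^ k ≤ n ^ k → m ≤ n
^-cancelˡ-≤ k m^k≤n^k = ≮⇒≥ λ n<m → <⇒≱ (^-monoˡ-< k n<m) m^k≤n^k

-- For `b > 0` and `a = b + k` this reads `(1 + 1/a)^k ≤ a / b`: each of the `k` factors
-- `(a + 1) / a` is at most `(j + 1) / j` for `j` from `b` to `a - 1`, and these telescope. The
-- induction keeps `a` fixed while `b` rises.
bernoulli : ∀ k b → suc (b + k) ^ k * b ≤ (b + k) ^ k * (b + k)
bernoulli zero    b = *-monoʳ-≤ 1 (m≤m+n b 0)
bernoulli (suc k) b rewrite +-suc b k = begin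
  suc a * suc a ^ k * b     ≡⟨ eq₁ (suc a) (suc a ^ k) b ⟩
  suc a ^ k * (suc a * b)   ≤⟨ *-monoʳ-≤ (suc a ^ k) step′ ⟩
  suc a ^ k * (suc b * a)   ≡⟨ *-assoc (suc a ^ k) (suc b) a ⟨
  suc a ^ k * suc b * a     ≤⟨ *-monoˡ-≤ a (bernoulli k (suc b)) ⟩
  a ^ k * a * a             ≡⟨ cong (_* a) (*-comm (a ^ k) a) ⟩
  a * a ^ k * a             ∎
  where
  open ≤-Reasoning
  a = suc (b + k)
  eq₁ : ∀ x y z → x * y * z ≡ y * (x * z)
  eq₁ = solve-∀
  step′ : suc a * b ≤ suc b * a
  step′ = begin
    b + a * b ≡⟨ cong (b +_) (*-comm a b) ⟩
    b + b * a ≤⟨ +-monoˡ-≤ (b * a) (≤-trans (m≤m+n b k) (n≤1+n _)) ⟩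
    a + b * a ∎

[1+1/2t]^t≤2 : ∀ t .{{_ : NonZero t}} → suc (t + t) ^ t ≤ 2 * (t + t) ^ t
[1+1/2t]^t≤2 t = *-cancelʳ-≤ (suc (t + t) ^ t) _ t (begin
  suc (t + t) ^ t * t   ≤⟨ bernoulli t t ⟩
  (t + t) ^ t * (t + t) ≡⟨ eq ((t + t) ^ t) t ⟩
  2 * (t + t) ^ t * t   ∎)
  where
  open ≤-Reasoning
  eq : ∀ x t → x * (t + t) ≡ 2 * x * t
  eq = solve-∀

-- Both sides are compared after raising to the power `t`, where the previous bound gives the factor
-- `2 ^ q ≤ 2 ^ (e * t)`. In effect `1 + 1/2t ≤ 2^(e/q)` as soon as `e/q ≥ 1/t`.
[1+1/2t]^q≤2^e : ∀ t .{{_ : NonZero t}} q e → q ≤ e * t → suc (t + t) ^ q ≤ 2 ^ e * (t + t) ^ q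
[1+1/2t]^q≤2^e t q e q≤et = ^-cancelˡ-≤ t (begin
  (a ^ q) ^ t                  ≡⟨ swap a q t ⟩
  (a ^ t) ^ q                  ≤⟨ ^-monoˡ-≤ q ([1+1/2t]^t≤2 t) ⟩
  (2 * b ^ t) ^ q              ≡⟨ ^-distribʳ-* q 2 (b ^ t) ⟩
  2 ^ q * (b ^ t) ^ q          ≤⟨ *-monoˡ-≤ ((b ^ t) ^ q) (^-monoʳ-≤ 2 q≤et) ⟩
  2 ^ (e * t) * (b ^ t) ^ q    ≡⟨ cong₂ _*_ (^-*-assoc 2 e t) (swap b q t) ⟨
  (2 ^ e) ^ t * (b ^ q) ^ t    ≡⟨ ^-distribʳ-* t (2 ^ e) (b ^ q) ⟨
  (2 ^ e * b ^ q) ^ t          ∎)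
  where
  open ≤-Reasoning
  a = suc (t + t)
  b = t + t
  swap : ∀ x m n → (x ^ m) ^ n ≡ (x ^ n) ^ m
  swap x m n = trans (^-*-assoc x m n) (trans (cong (x ^_) (*-comm m n)) (sym (^-*-assoc x n m)))

-- x ≤ K · (num / den) ^ (p / q)
record PowBound (p q K num den x : ℕ) : Set where
  constructor powBound
  field inequality : x ^ q * den ^ p ≤ K ^ q * num ^ p


module _ {p q : ℕ} where
  open ≤-Reasoning

  PowBound-≤ : ∀ {K K′ n d x x′} → K ≤ K′ → x′ ≤ x → PowBound p q K n d x → PowBound p q K′ n d x′
  PowBound-≤ {K} {K′} {n} {d} K≤K′ x′≤x (powBound h) =
    powBound (≤-trans (*-monoˡ-≤ (d ^ p) (^-monoˡ-≤ q x′≤x))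
      (≤-trans h (*-monoˡ-≤ (n ^ p) (^-monoˡ-≤ q K≤K′))))

  PowBound-1 : ∀ {K n d x} → 0 < K → d ≤ n → x ≤ 1 → PowBound p q K n d x
  PowBound-1 0<K d≤n x≤1 = powBound (*-mono-≤ (^-monoˡ-≤ q (≤-trans x≤1 0<K)) (^-monoˡ-≤ p d≤n))

  private
    add-aux : ∀ {a b n d x y} .{{_ : NonZero b}} → x * b ≤ y * a →
              PowBound p q b n d y → PowBound p q (a + b) n d (x + y)
    add-aux {a} {b} {n} {d} {x} {y} xb≤ya (powBound h) =
      powBound (*-cancelˡ-≤ (b ^ q) {{m^n≢0 b q}} (begin
        b ^ q * ((x + y) ^ q * d ^ p)       ≡⟨ *-assoc (b ^ q) _ _ ⟨
        b ^ q * (x + y) ^ q * d ^ p         ≡⟨ cong (_* d ^ p) (^-distribʳ-* q b (x + y)) ⟨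
        (b * (x + y)) ^ q * d ^ p           ≤⟨ *-monoˡ-≤ (d ^ p) (^-monoˡ-≤ q le) ⟩
        ((a + b) * y) ^ q * d ^ p           ≡⟨ cong (_* d ^ p) (^-distribʳ-* q (a + b) y) ⟩
        (a + b) ^ q * y ^ q * d ^ p         ≡⟨ *-assoc ((a + b) ^ q) _ _ ⟩
        (a + b) ^ q * (y ^ q * d ^ p)       ≤⟨ *-monoʳ-≤ ((a + b) ^ q) h ⟩
        (a + b) ^ q * (b ^ q * n ^ p)       ≡⟨ eq₃ ((a + b) ^ q) (b ^ q) (n ^ p) ⟩
        b ^ q * ((a + b) ^ q * n ^ p)       ∎))
      where
      eq₁ : ∀ b x y → b * (x + y) ≡ x * b + b * y
      eq₁ = solve-∀
      eq₂ : ∀ a b y → y * a + b * y ≡ (a + b) * y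
      eq₂ = solve-∀
      eq₃ : ∀ u v w → u * (v * w) ≡ v * (u * w)
      eq₃ = solve-∀
      le : b * (x + y) ≤ (a + b) * y
      le = begin
        b * (x + y)     ≡⟨ eq₁ b x y ⟩
        x * b + b * y   ≤⟨ +-monoˡ-≤ (b * y) xb≤ya ⟩
        y * a + b * y   ≡⟨ eq₂ a b y ⟩
        (a + b) * y     ∎

  -- num / den to the power p / q is irrational in general; comparing x / a with y / b
  -- reduces the sum to the summand with the larger ratio.
  PowBound-+ : ∀ {a b n d x y} .{{_ : NonZero a}} .{{_ : NonZero b}} →
               PowBound p q a n d x → PowBound p q b n d y → PowBound p q (a + b) n d (x + y)
  PowBound-+ {a} {b} {n} {d} {x} {y} hx hy with ≤-total (x * b) (y * a)
  ... | inj₁ le = add-aux le hy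
  ... | inj₂ ge = subst₂ (λ K z → PowBound p q K n d z) (+-comm b a) (+-comm y x) (add-aux ge hx)

  PowBound-*ˡ : ∀ c {K n d x} → PowBound p q K n d x → PowBound p q (c * K) n d (c * x)
  PowBound-*ˡ c {K} {n} {d} {x} (powBound h) = powBound (begin
    (c * x) ^ q * d ^ p     ≡⟨ cong (_* d ^ p) (^-distribʳ-* q c x) ⟩
    c ^ q * x ^ q * d ^ p   ≡⟨ *-assoc (c ^ q) _ _ ⟩
    c ^ q * (x ^ q * d ^ p) ≤⟨ *-monoʳ-≤ (c ^ q) h ⟩
    c ^ q * (K ^ q * n ^ p) ≡⟨ *-assoc (c ^ q) _ _ ⟨
    c ^ q * K ^ q * n ^ p   ≡⟨ cong (_* n ^ p) (^-distribʳ-* q c K) ⟨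
    (c * K) ^ q * n ^ p     ∎)

  -- Taking the power `p/q` of `M^(1+s) · n/d` costs a factor `M^((1+s) p/q)`; the condition
  -- `p/q ≤ s/(1+s)` caps it at `M^s`, one natural number for all admissible exponents.
  PowBound-rescale : ∀ {K M N n d x s} .{{_ : NonZero M}} → p * suc s ≤ s * q →
    N * d ≤ M ^ suc s * n → PowBound p q K N 1 x → PowBound p q (K * M ^ s) n d x
  PowBound-rescale {K} {M} {N} {n} {d} {x} {s} ps≤sq Nd≤ (powBound h) = powBound (begin
    x ^ q * d ^ p                         ≡⟨ cong (_* d ^ p) (trans (cong (x ^ q *_) (^-zeroˡ p)) (*-identityʳ (x ^ q))) ⟨
    x ^ q * 1 ^ p * d ^ p                 ≤⟨ *-monoˡ-≤ (d ^ p) h ⟩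
    K ^ q * N ^ p * d ^ p                 ≡⟨ *-assoc (K ^ q) _ _ ⟩
    K ^ q * (N ^ p * d ^ p)               ≡⟨ cong (K ^ q *_) (^-distribʳ-* p N d) ⟨
    K ^ q * (N * d) ^ p                   ≤⟨ *-monoʳ-≤ (K ^ q) (^-monoˡ-≤ p Nd≤) ⟩
    K ^ q * (M ^ suc s * n) ^ p           ≡⟨ cong (K ^ q *_) (^-distribʳ-* p (M ^ suc s) n) ⟩
    K ^ q * ((M ^ suc s) ^ p * n ^ p)     ≤⟨ *-monoʳ-≤ (K ^ q) (*-monoˡ-≤ (n ^ p) M-le) ⟩
    K ^ q * ((M ^ s) ^ q * n ^ p)         ≡⟨ *-assoc (K ^ q) _ _ ⟨
    K ^ q * (M ^ s) ^ q * n ^ p           ≡⟨ cong (_* n ^ p) (^-distribʳ-* q K (M ^ s)) ⟨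
    (K * M ^ s) ^ q * n ^ p               ∎)
    where
    M-le : (M ^ suc s) ^ p ≤ (M ^ s) ^ q
    M-le = begin
      (M ^ suc s) ^ p  ≡⟨ ^-*-assoc M (suc s) p ⟩
      M ^ (suc s * p)  ≤⟨ ^-monoʳ-≤ M (subst (_≤ s * q) (*-comm p (suc s)) ps≤sq) ⟩
      M ^ (s * q)      ≡⟨ ^-*-assoc M s q ⟨
      (M ^ s) ^ q      ∎

  private
    tD-≤ : ∀ t .{{_ : NonZero t}} D n e → q ≤ e * t →
           (suc (t + t) * D) ^ q * n ^ p ≤ 2 ^ e * (((t + t) * D) ^ q * n ^ p)
    tD-≤ t D n e q≤et = begin
      (suc (t + t) * D) ^ q * n ^ p              ≡⟨ cong (_* n ^ p) (^-distribʳ-* q (suc (t + t)) D) ⟩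
      suc (t + t) ^ q * D ^ q * n ^ p            ≤⟨ *-monoˡ-≤ (n ^ p) (*-monoˡ-≤ (D ^ q) ([1+1/2t]^q≤2^e t q e q≤et)) ⟩
      2 ^ e * (t + t) ^ q * D ^ q * n ^ p        ≡⟨ eq (2 ^ e) ((t + t) ^ q) (D ^ q) (n ^ p) ⟩
      2 ^ e * ((t + t) ^ q * D ^ q * n ^ p)      ≡⟨ cong (λ z → 2 ^ e * (z * n ^ p)) (^-distribʳ-* q (t + t) D) ⟨
      2 ^ e * (((t + t) * D) ^ q * n ^ p)        ∎
      where
      eq : ∀ a b c d → a * b * c * d ≡ a * (b * c * d)
      eq = solve-∀

  -- Halving both x and num / den gains 2 ^ (1 - p / q), which is at least 1 + 1 / 2t once q ≤ (q - p) t.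
  PowBound-halve : ∀ t .{{_ : NonZero t}} {D n d x} → p * t + q ≤ q * t →
    PowBound p q (suc (t + t) * D) n d (2 * x) → PowBound p q ((t + t) * D) n (2 * d) x
  PowBound-halve t {D} {n} {d} {x} cond (powBound h) =
    powBound (*-cancelˡ-≤ (2 ^ q) {{m^n≢0 2 q}} (begin
      2 ^ q * (x ^ q * (2 * d) ^ p)          ≡⟨ cong (λ z → 2 ^ q * (x ^ q * z)) (^-distribʳ-* p 2 d) ⟩
      2 ^ q * (x ^ q * (2 ^ p * d ^ p))      ≡⟨ eq₁ (2 ^ q) (x ^ q) (2 ^ p) (d ^ p) ⟩
      2 ^ p * (2 ^ q * x ^ q * d ^ p)        ≡⟨ cong (λ z → 2 ^ p * (z * d ^ p)) (^-distribʳ-* q 2 x) ⟨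
      2 ^ p * ((2 * x) ^ q * d ^ p)          ≤⟨ *-monoʳ-≤ (2 ^ p) h ⟩
      2 ^ p * ((suc (t + t) * D) ^ q * n ^ p) ≤⟨ *-monoʳ-≤ (2 ^ p) (tD-≤ t D n e q≤et) ⟩
      2 ^ p * (2 ^ e * R)                    ≡⟨ *-assoc (2 ^ p) (2 ^ e) R ⟨
      2 ^ p * 2 ^ e * R                      ≡⟨ cong (_* R) (^-distribˡ-+-* 2 p e) ⟨
      2 ^ (p + e) * R                        ≡⟨ cong (λ z → 2 ^ z * R) (m+[n∸m]≡n p≤q) ⟩
      2 ^ q * R                              ∎))
    where
    R = ((t + t) * D) ^ q * n ^ p
    e = q ∸ p
    p≤q : p ≤ q
    p≤q = *-cancelʳ-≤ p q t (≤-trans (m≤m+n (p * t) q) cond)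
    q≤et : q ≤ e * t
    q≤et = subst (q ≤_) (sym (*-distribʳ-∸ t q p)) (m+n≤o⇒m≤o∸n q (subst (_≤ q * t) (+-comm (p * t) q) cond))
    eq₁ : ∀ a b c d → a * (b * (c * d)) ≡ c * (a * b * d)
    eq₁ = solve-∀

  -- Passing from `n / 2d` to `n / d` gains `2^(p/q)`, which is at least `1 + 1/2t` once
  -- `p/q ≥ 1/t`. This sums the geometric series of bags along a path.
  PowBound-double : ∀ t .{{_ : NonZero t}} {D n d x} → q ≤ p * t →
    PowBound p q (suc (t + t) * D) n (2 * d) x → PowBound p q ((t + t) * D) n d x
  PowBound-double t {D} {n} {d} {x} q≤pt (powBound h) =
    powBound (*-cancelˡ-≤ (2 ^ p) {{m^n≢0 2 p}} (begin
      2 ^ p * (x ^ q * d ^ p)            ≡⟨ eq (2 ^ p) (x ^ q) (d ^ p) ⟩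
      x ^ q * (2 ^ p * d ^ p)            ≡⟨ cong (x ^ q *_) (^-distribʳ-* p 2 d) ⟨
      x ^ q * (2 * d) ^ p                ≤⟨ h ⟩
      (suc (t + t) * D) ^ q * n ^ p      ≤⟨ tD-≤ t D n p q≤pt ⟩
      2 ^ p * (((t + t) * D) ^ q * n ^ p) ∎))
    where
    eq : ∀ a b c → a * (b * c) ≡ b * (a * c)
    eq = solve-∀

-- As `n / d ≥ 1`, its powers grow with the exponent. Over the common denominator `q * q′` the new
-- exponent exceeds the old by `δ`, which contributes `d ^ δ ≤ n ^ δ`.
PowBound-exponent : ∀ {p q p′ q′ K n d x} .{{_ : NonZero q}} → d ≤ n → p * q′ ≤ p′ * q →
  PowBound p q K n d x → PowBound p′ q′ K n d x
PowBound-exponent {p} {q} {p′} {q′} {K} {n} {d} {x} d≤n le (powBound h) = powBound (^-cancelˡ-≤ q (begin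
  (x ^ q′ * d ^ p′) ^ q                       ≡⟨ expand x d ⟩
  (x ^ q * d ^ p) ^ q′ * d ^ δ                ≤⟨ *-mono-≤ (^-monoˡ-≤ q′ h) (^-monoˡ-≤ δ d≤n) ⟩
  (K ^ q * n ^ p) ^ q′ * n ^ δ                ≡⟨ expand K n ⟨
  (K ^ q′ * n ^ p′) ^ q                       ∎))
  where
  open ≤-Reasoning
  δ = p′ * q ∸ p * q′
  swap : ∀ y → (y ^ q′) ^ q ≡ (y ^ q) ^ q′
  swap y = trans (^-*-assoc y q′ q) (trans (cong (y ^_) (*-comm q′ q)) (sym (^-*-assoc y q q′)))
  expand : ∀ y z → (y ^ q′ * z ^ p′) ^ q ≡ (y ^ q * z ^ p) ^ q′ * z ^ δ
  expand y z = begin-equality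
    (y ^ q′ * z ^ p′) ^ q                  ≡⟨ ^-distribʳ-* q (y ^ q′) (z ^ p′) ⟩
    (y ^ q′) ^ q * (z ^ p′) ^ q            ≡⟨ cong₂ _*_ (swap y) (^-*-assoc z p′ q) ⟩
    (y ^ q) ^ q′ * z ^ (p′ * q)            ≡⟨ cong (λ w → (y ^ q) ^ q′ * z ^ w) (m+[n∸m]≡n le) ⟨
    (y ^ q) ^ q′ * z ^ (p * q′ + δ)        ≡⟨ cong ((y ^ q) ^ q′ *_) (^-distribˡ-+-* z (p * q′) δ) ⟩
    (y ^ q) ^ q′ * (z ^ (p * q′) * z ^ δ)  ≡⟨ *-assoc ((y ^ q) ^ q′) _ _ ⟨
    (y ^ q) ^ q′ * z ^ (p * q′) * z ^ δ    ≡⟨ cong (λ w → (y ^ q) ^ q′ * w * z ^ δ) (^-*-assoc z p q′) ⟨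
    (y ^ q) ^ q′ * (z ^ p) ^ q′ * z ^ δ    ≡⟨ cong (_* z ^ δ) (^-distribʳ-* q′ (y ^ q) (z ^ p)) ⟨
    (y ^ q * z ^ p) ^ q′ * z ^ δ           ∎

-- BoundedBy unfolds to inequalities between powers, from which K, num, den and x cannot be
-- inferred; the records PowBound and Bounded keep them visible to unification.
record Bounded (α : Exponent) (K num den x : ℕ) : Set where
  constructor bounded
  field at : ∀ {p q} → Above α p q → PowBound p (suc q) K num den x
open Bounded

module _ {α : Exponent} where

  Bounded⇒BoundedBy : ∀ {K n d x} → Bounded α K n d x → BoundedBy α K n d x
  Bounded⇒BoundedBy h p q above = PowBound.inequality (at h above)

  BoundedBy⇒Bounded : ∀ K n d x → BoundedBy α K n d x → Bounded α K n d x
  BoundedBy⇒Bounded K n d x h = bounded λ above → powBound (h _ _ above)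

  Bounded-≤ : ∀ {K K′ n d x x′} → K ≤ K′ → x′ ≤ x → Bounded α K n d x → Bounded α K′ n d x′
  Bounded-≤ K≤K′ x′≤x h = bounded λ above → PowBound-≤ K≤K′ x′≤x (at h above)

  Bounded-+ : ∀ {a b n d x y} .{{_ : NonZero a}} .{{_ : NonZero b}} →
              Bounded α a n d x → Bounded α b n d y → Bounded α (a + b) n d (x + y)
  Bounded-+ hx hy = bounded λ above → PowBound-+ (at hx above) (at hy above)

-- Powers of two around the binary logarithm

2^⌊log2⌋≤n : ∀ n (rs : Acc _<_ (suc n)) → 2 ^ ⌊log2⌋ (suc n) rs ≤ suc n
2^⌊log2⌋≤n zero    _        = ≤-refl
2^⌊log2⌋≤n (suc n) (acc rs) = begin
  2 * 2 ^ ⌊log2⌋ (suc ⌊ n /2⌋) _ ≤⟨ *-monoʳ-≤ 2 (2^⌊log2⌋≤n ⌊ n /2⌋ _) ⟩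
  2 * suc ⌊ n /2⌋                ≡⟨ cong (λ z → suc ⌊ n /2⌋ + suc z) (+-identityʳ ⌊ n /2⌋) ⟩
  suc ⌊ n /2⌋ + suc ⌊ n /2⌋      ≤⟨ +-monoʳ-≤ (suc ⌊ n /2⌋) (s≤s (⌊n/2⌋≤⌈n/2⌉ n)) ⟩
  suc ⌊ n /2⌋ + suc ⌈ n /2⌉      ≡⟨ cong suc (+-suc ⌊ n /2⌋ ⌈ n /2⌉) ⟩
  suc (suc (⌊ n /2⌋ + ⌈ n /2⌉))  ≡⟨ cong (λ z → suc (suc z)) (⌊n/2⌋+⌈n/2⌉≡n n) ⟩
  suc (suc n)                    ∎
  where open ≤-Reasoning

2^⌊log₂n⌋≤n : ∀ n → 2 ^ ⌊log₂ suc n ⌋ ≤ suc n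
2^⌊log₂n⌋≤n n = 2^⌊log2⌋≤n n (<-wellFounded (suc n))

n<2^[1+⌊log₂n⌋] : ∀ n → n < 2 ^ suc ⌊log₂ n ⌋
n<2^[1+⌊log₂n⌋] n = ≰⇒> λ le → 1+n≰n (subst (_≤ ⌊log₂ n ⌋) (⌊log₂[2^n]⌋≡n _) (⌊log₂⌋-mono-≤ le))

-- Finite subsets

comprehension : ∀ {n} {P : Fin n → Set} → Decidable P → Subset n
comprehension P? = tabulate (does ∘ P?)

module _ {n} {P : Fin n → Set} (P? : Decidable P) where

  comprehension⁺ : ∀ {v} → P v → v ∈ comprehension P?
  comprehension⁺ {v} Pv = lookup⇒[]= v _ (trans (lookup∘tabulate (does ∘ P?) v) (dec-true (P? v) Pv))

  comprehension⁻ : ∀ {v} → v ∈ comprehension P? → P v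
  comprehension⁻ {v} v∈ with P? v | trans (sym (lookup∘tabulate (does ∘ P?) v)) ([]=⇒lookup v∈)
  ... | yes Pv | _ = Pv

∣p∪q∣≤∣p∣+∣q∣ : ∀ {n} (p q : Subset n) → ∣ p ∪ q ∣ ≤ ∣ p ∣ + ∣ q ∣
∣p∪q∣≤∣p∣+∣q∣ []            []            = z≤n
∣p∪q∣≤∣p∣+∣q∣ (outside ∷ p) (outside ∷ q) = ∣p∪q∣≤∣p∣+∣q∣ p q
∣p∪q∣≤∣p∣+∣q∣ (outside ∷ p) (inside  ∷ q) = subst (suc ∣ p ∪ q ∣ ≤_) (sym (+-suc ∣ p ∣ ∣ q ∣)) (s≤s (∣p∪q∣≤∣p∣+∣q∣ p q))
∣p∪q∣≤∣p∣+∣q∣ (inside  ∷ p) (outside ∷ q) = s≤s (∣p∪q∣≤∣p∣+∣q∣ p q)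
∣p∪q∣≤∣p∣+∣q∣ (inside  ∷ p) (inside  ∷ q) = s≤s (≤-trans (∣p∪q∣≤∣p∣+∣q∣ p q) (+-monoʳ-≤ ∣ p ∣ (n≤1+n ∣ q ∣)))

disjoint⇒∣p∣+∣q∣≤∣r∣ : ∀ {n} {p q r : Subset n} → p ⊆ r → q ⊆ r → (∀ {v} → v ∈ p → v ∉ q) →
                        ∣ p ∣ + ∣ q ∣ ≤ ∣ r ∣
disjoint⇒∣p∣+∣q∣≤∣r∣ {p = []} {[]} {[]} _ _ _ = z≤n
disjoint⇒∣p∣+∣q∣≤∣r∣ {p = outside ∷ p} {outside ∷ q} {x ∷ r} p⊆r q⊆r d =
  ≤-trans (disjoint⇒∣p∣+∣q∣≤∣r∣ (drop-∷-⊆ p⊆r) (drop-∷-⊆ q⊆r) λ v∈p v∈q → d (there v∈p) (there v∈q)) (∣p∣≤∣x∷p∣ x r)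
disjoint⇒∣p∣+∣q∣≤∣r∣ {p = inside ∷ p} {outside ∷ q} {x ∷ r} p⊆r q⊆r d with here ← p⊆r here =
  s≤s (disjoint⇒∣p∣+∣q∣≤∣r∣ (drop-∷-⊆ p⊆r) (drop-∷-⊆ q⊆r) λ v∈p v∈q → d (there v∈p) (there v∈q))
disjoint⇒∣p∣+∣q∣≤∣r∣ {p = outside ∷ p} {inside ∷ q} {x ∷ r} p⊆r q⊆r d with here ← q⊆r here =
  subst (_≤ suc ∣ r ∣) (sym (+-suc ∣ p ∣ ∣ q ∣))
    (s≤s (disjoint⇒∣p∣+∣q∣≤∣r∣ (drop-∷-⊆ p⊆r) (drop-∷-⊆ q⊆r) λ v∈p v∈q → d (there v∈p) (there v∈q)))
disjoint⇒∣p∣+∣q∣≤∣r∣ {p = inside ∷ p} {inside ∷ q} {x ∷ r} _ _ d = contradiction here (d here)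

-- A relation replaces a function because the partners mostly come from existence proofs valid on
-- `p` only. The induction removes the partner of the first element from `q`.
injection⇒∣p∣≤∣q∣ : ∀ {m n} {p : Subset m} {q : Subset n} (R : Fin m → Fin n → Set) →
  (∀ v → v ∈ p → ∃ λ w → w ∈ q × R v w) → (∀ {v v′ w} → R v w → R v′ w → v ≡ v′) → ∣ p ∣ ≤ ∣ q ∣
injection⇒∣p∣≤∣q∣ {p = []} R total inj = z≤n
injection⇒∣p∣≤∣q∣ {p = outside ∷ p} R total inj =
  injection⇒∣p∣≤∣q∣ (R ∘ suc) (λ v v∈p → total (suc v) (there v∈p)) (λ r r′ → Fin.suc-injective (inj r r′))
injection⇒∣p∣≤∣q∣ {p = inside ∷ p} {q} R total inj with total zero here
... | w₀ , w₀∈q , r₀ = ≤-trans (s≤s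
  (injection⇒∣p∣≤∣q∣ {q = q - w₀} (R ∘ suc)
    (λ v v∈p → let w , w∈q , r = total (suc v) (there v∈p) in
      w , x∈p∧x≢y⇒x∈p-y w∈q (λ { refl → Fin.0≢1+n (inj r₀ r) }) , r)
    (λ r r′ → Fin.suc-injective (inj r r′))))
  (x∈p⇒∣p-x∣<∣p∣ w₀∈q)

enumerate : ∀ {n} (p : Subset n) → Fin ∣ p ∣ → Fin n
enumerate (outside ∷ p) i       = suc (enumerate p i)
enumerate (inside  ∷ p) zero    = zero
enumerate (inside  ∷ p) (suc i) = suc (enumerate p i)

enumerate-∈ : ∀ {n} (p : Subset n) i → enumerate p i ∈ p
enumerate-∈ (outside ∷ p) i       = there (enumerate-∈ p i)
enumerate-∈ (inside  ∷ p) zero    = here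
enumerate-∈ (inside  ∷ p) (suc i) = there (enumerate-∈ p i)

enumerate-injective : ∀ {n} (p : Subset n) → Injective _≡_ _≡_ (enumerate p)
enumerate-injective (outside ∷ p) eq = enumerate-injective p (Fin.suc-injective eq)
enumerate-injective (inside  ∷ p) {zero}  {zero}  eq = refl
enumerate-injective (inside  ∷ p) {suc i} {suc j} eq = cong suc (enumerate-injective p (Fin.suc-injective eq))

enumerate-surjective : ∀ {n} (p : Subset n) {v} → v ∈ p → ∃ λ i → enumerate p i ≡ v
enumerate-surjective (outside ∷ p) (there v∈p) = let i , eq = enumerate-surjective p v∈p in i , cong suc eq
enumerate-surjective (inside  ∷ p) here        = zero , refl
enumerate-surjective (inside  ∷ p) (there v∈p) = let i , eq = enumerate-surjective p v∈p in suc i , cong suc eq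

-- Separators and colourings of components

module _ {n} {G : Graph n} where

  walk-start : ∀ {X u v} → Walk G X u v → u ∉ X
  walk-start (stop u∉X)     = u∉X
  walk-start (step u∉X _ _) = u∉X

  walk-trans : ∀ {X u v w} → Walk G X u v → Walk G X v w → Walk G X u w
  walk-trans (stop _)         q = q
  walk-trans (step u∉X uv p) q = step u∉X uv (walk-trans p q)

  walk-sym : ∀ {X u v} → Walk G X u v → Walk G X v u
  walk-sym (stop u∉X) = stop u∉X
  walk-sym (step {u} {w} u∉X uw p) =
    walk-trans (walk-sym p) (step (walk-start p) (trans (adj-sym G w u) uw) (stop u∉X))

  walk-⊆ : ∀ {X Y u v} → Y ⊆ X → Walk G X u v → Walk G Y u v
  walk-⊆ Y⊆X (stop u∉X)       = stop (u∉X ∘ Y⊆X)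
  walk-⊆ Y⊆X (step u∉X uw p) = step (u∉X ∘ Y⊆X) uw (walk-⊆ Y⊆X p)

module _ {n} (G : Graph n) (A : Subset n) (X : Subset n) (X′ : Subset ∣ A ∣)
         (X′⊆X : ∀ i → i ∈ X′ → enumerate A i ∈ X) where

  -- Removing `∁ A` together with `X` keeps the walk inside `A`, so each of its vertices has an
  -- index in the enumeration. The endpoints enter through equations so that the walk can be matched
  -- on.
  walk-induced : ∀ {u v} → Walk G (X ∪ ∁ A) u v → ∀ i j → enumerate A i ≡ u → enumerate A j ≡ v →
                 Walk (induced G (enumerate A)) X′ i j
  walk-induced (stop u∉) i j refl ej with refl ← enumerate-injective A {j} {i} ej =
    stop λ i∈X′ → u∉ (x∈p∪q⁺ (inj₁ (X′⊆X i i∈X′)))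
  walk-induced (step {w = w} u∉ uw p) i j refl ej
    with k , refl ← enumerate-surjective A {w} (x∉∁p⇒x∈p (λ w∈ → walk-start p (x∈p∪q⁺ (inj₂ w∈)))) =
    step (λ i∈X′ → u∉ (x∈p∪q⁺ (inj₁ (X′⊆X i i∈X′)))) uw (walk-induced p k j refl ej)

-- Separability is applied to `G[A]`, so that the bound depends on `∣ A ∣` and not on `n`; `X` is
-- the image of the separator found there. Deleting `∁ A` as well turns walks of `G` into walks of
-- `G[A]`.
relative-separator : ∀ {α} {𝒞 : GraphClass} → Hereditary 𝒞 → (s : Separable 𝒞 α) →
  ∀ {n} (G : Graph n) → 𝒞 G → (A S : Subset n) → S ⊆ A →
  Σ (Subset n) λ X → Bounded α (proj₁ s) (∣ A ∣) 1 (∣ X ∣) × BalancedSeparator G S (X ∪ ∁ A)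
relative-separator {α} her (K , separate) {n} G G∈𝒞 A S S⊆A
  with separate (induced G (enumerate A)) (her G (enumerate A) (enumerate-injective A) G∈𝒞)
                (comprehension (λ i → enumerate A i ∈? S))
... | X′ , bound , balanced = X , X-bound , X-balanced
  where
  e = enumerate A
  InX : Fin n → Set
  InX v = ∃ λ i → i ∈ X′ × e i ≡ v
  InX? : Decidable InX
  InX? v = Fin.any? λ i → (i ∈? X′) ×-dec (e i Fin.≟ v)
  X = comprehension InX?
  X-bound : Bounded α K (∣ A ∣) 1 (∣ X ∣)
  X-bound = Bounded-≤ ≤-refl
    (injection⇒∣p∣≤∣q∣ (λ v i → e i ≡ v) (λ v v∈X → comprehension⁻ InX? v∈X)
      (λ r r′ → trans (sym r) r′))
    (BoundedBy⇒Bounded K (∣ A ∣) 1 (∣ X′ ∣) bound)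
  X-balanced : BalancedSeparator G S (X ∪ ∁ A)
  X-balanced v v∉ T T-reach with enumerate-surjective A {v} (x∉∁p⇒x∈p (λ v∈ → v∉ (x∈p∪q⁺ (inj₂ v∈))))
  ... | i , refl = begin
    2 * ∣ T ∣   ≤⟨ *-monoʳ-≤ 2 (injection⇒∣p∣≤∣q∣ (λ v j → e j ≡ v) (λ w w∈T →
        let j , ej = enumerate-surjective A (S⊆A (proj₁ (T-reach w w∈T))) in
        j , comprehension⁺ T? (subst (_∈ T) (sym ej) w∈T) , ej)
      (λ r r′ → trans (sym r) r′)) ⟩
    2 * ∣ T′ ∣  ≤⟨ balanced i (λ i∈X′ → v∉ (x∈p∪q⁺ (inj₁ (X′⊆X i i∈X′)))) T′ (λ j j∈T′ →
        let S∋ , walk = T-reach (e j) (comprehension⁻ T? j∈T′) in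
        comprehension⁺ (λ i → e i ∈? S) S∋ , walk-induced G A X X′ X′⊆X walk i j refl refl) ⟩
    ∣ comprehension (λ i → e i ∈? S) ∣ ≤⟨ injection⇒∣p∣≤∣q∣ (λ j v → e j ≡ v)
        (λ j j∈ → e j , comprehension⁻ (λ i → e i ∈? S) j∈ , refl)
        (λ r r′ → enumerate-injective A (trans r (sym r′))) ⟩
    ∣ S ∣       ∎
    where
    open ≤-Reasoning
    T? : Decidable (λ j → e j ∈ T)
    T? j = e j ∈? T
    T′ = comprehension T?
    X′⊆X : ∀ i → i ∈ X′ → e i ∈ X
    X′⊆X i i∈X′ = comprehension⁺ InX? (i , i∈X′ , refl)

-- Components of `G - Y` as classes of a labelling

module _ {n} (G : Graph n) (Y : Subset n) where

  -- Equality is a separate alternative because walks avoid `Y`, while the labelling also covers the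
  -- vertices of `Y`.
  Connected : Fin n → Fin n → Set
  Connected u v = u ≡ v ⊎ Walk G Y u v

  connected-sym : ∀ {u v} → Connected u v → Connected v u
  connected-sym = [ inj₁ ∘ sym , inj₂ ∘ walk-sym ]′

  connected-trans : ∀ {u v w} → Connected u v → Connected v w → Connected u w
  connected-trans (inj₁ refl) q           = q
  connected-trans (inj₂ p)    (inj₁ refl) = inj₂ p
  connected-trans (inj₂ p)    (inj₂ q)    = inj₂ (walk-trans p q)

  ComponentEdge : Fin n → Fin n → Set
  ComponentEdge u v = u ∉ Y × v ∉ Y × adj G u v ≡ true

  private
    redirect : Fin n → Fin n → Fin n → Fin n
    redirect a b x = if does (x Fin.≟ a) then b else x

    redirect-source : ∀ a b → redirect a b a ≡ b
    redirect-source a b with a Fin.≟ a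
    ... | yes _  = refl
    ... | no a≢a = contradiction refl a≢a

    redirect-target : ∀ a b → redirect a b b ≡ b
    redirect-target a b with b Fin.≟ a
    ... | yes _ = refl
    ... | no  _ = refl

    -- Starts with distinct labels and, edge by edge, redirects the label of one end to that of the
    -- other. Labels merge only along edges of `G - Y`, and edges treated earlier stay respected
    -- because equal labels are redirected together.
    label : (es : List (Fin n × Fin n)) → Σ (Fin n → Fin n) λ c →
      (∀ u v → c u ≡ c v → Connected u v) ×
      (∀ u v → (u , v) List.∈ es → ComponentEdge u v → c u ≡ c v)
    label [] = (λ v → v) , (λ u v → inj₁) , λ _ _ ()
    label ((u , v) ∷ es) with label es | ¬? (u ∈? Y) ×-dec (¬? (v ∈? Y) ×-dec (adj G u v Bool.≟ true))
    ... | c , conn , edge | no ¬uv = c , conn , λ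
      { _ _ (here refl) uv → contradiction uv ¬uv
      ; x y (there xy∈) xy → edge x y xy∈ xy }
    ... | c , conn , edge | yes uv@(u∉Y , v∉Y , u~v) = redirect (c u) (c v) ∘ c , conn′ , λ
      { _ _ (here refl) _  → trans (redirect-source (c u) (c v)) (sym (redirect-target (c u) (c v)))
      ; x y (there xy∈) xy → cong (redirect (c u) (c v)) (edge x y xy∈ xy) }
      where
      v-u : Connected v u
      v-u = inj₂ (step v∉Y (trans (adj-sym G v u) u~v) (stop u∉Y))
      conn′ : ∀ x y → redirect (c u) (c v) (c x) ≡ redirect (c u) (c v) (c y) → Connected x y
      conn′ x y eq with c x Fin.≟ c u | c y Fin.≟ c u
      ... | yes xu | yes yu = conn x y (trans xu (sym yu))
      ... | yes xu | no _   = connected-trans (conn x u xu) (connected-trans (connected-sym v-u) (conn v y eq))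
      ... | no _   | yes yu = connected-trans (conn x v eq) (connected-trans v-u (conn u y (sym yu)))
      ... | no _   | no _   = conn x y eq

  component-labelling : Σ (Fin n → Fin n) λ c →
    (∀ u v → c u ≡ c v → Connected u v) × (∀ u v → ComponentEdge u v → c u ≡ c v)
  component-labelling with label (cartesianProduct (allFin n) (allFin n))
  ... | c , conn , edge =
    c , conn , λ u v → edge u v (∈-cartesianProduct⁺ (∈-allFin u) (∈-allFin v))

module _ {n k} (Y : Subset n) (c : Fin n → Fin k) where

  colourClass? : (S : Subset n) (j : Fin k) → Decidable (λ v → v ∈ S × v ∉ Y × c v ≡ j)
  colourClass? S j v = (v ∈? S) ×-dec (¬? (v ∈? Y) ×-dec (c v Fin.≟ j))

  colourClass : Subset n → Fin k → Subset n
  colourClass S j = comprehension (colourClass? S j)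

  Halves : Subset n → Fin k → Set
  Halves S j = 2 * ∣ colourClass S j ∣ ≤ ∣ S ∣

module _ {n} (G : Graph n) {S X Y : Subset n} (balanced : BalancedSeparator G S X) (X⊆Y : X ⊆ Y) where

  -- A nonempty class lies in the component of any of its members in `G - Y`, hence, by `X ⊆ Y`, in
  -- one component of `G - X`, where the balance of `X` applies.
  connected-classes-halve : ∀ {k} (c : Fin n → Fin k) → (∀ u v → c u ≡ c v → Connected G Y u v) →
                            ∀ j → Halves Y c S j
  connected-classes-halve c conn j with nonempty? (colourClass Y c S j)
  ... | no empty rewrite Empty-unique empty | ∣⊥∣≡0 n = z≤n
  ... | yes (v , v∈) with comprehension⁻ (colourClass? Y c S j) v∈
  ... | _ , v∉Y , cv = balanced v (v∉Y ∘ X⊆Y) (colourClass Y c S j) λ u u∈ →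
    let u∈S , u∉Y , cu = comprehension⁻ (colourClass? Y c S j) u∈
    in u∈S , [ (λ { refl → stop (v∉Y ∘ X⊆Y) }) , walk-⊆ X⊆Y ]′ (conn v u (trans cv (sym cu)))

-- Merging colour classes down to five

pinch-suc : ∀ {n} (i : Fin n) → pinch i (suc i) ≡ i
pinch-suc zero    = refl
pinch-suc (suc i) = cong suc (pinch-suc i)

module _ {n} (Y : Subset n) where

  private
    -- `pinch i` identifies the colours `i` and `i + 1` and no others, so the class of any `j` other
    -- than `i` sits inside a single old class.
    pinch-halves : ∀ {k} (c : Fin n → Fin (suc k)) (S : Subset n) (i : Fin k) →
      (∀ j → Halves Y c S j) → Halves Y (pinch i ∘ c) S i → ∀ j → Halves Y (pinch i ∘ c) S j
    pinch-halves c S i halves half-i j with i Fin.≟ j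
    ... | yes refl = half-i
    ... | no i≢j with Fin.pinch-surjective i j
    ... | y , pinch-y = ≤-trans (*-monoʳ-≤ 2 (p⊆q⇒∣p∣≤∣q∣ λ v∈ →
            let v∈S , v∉Y , cv = comprehension⁻ (colourClass? Y (pinch i ∘ c) S j) v∈
            in comprehension⁺ (colourClass? Y c S y)
                 (v∈S , v∉Y , Fin.pinch-injective {i = i} (suc≢ cv) (suc≢ (pinch-y refl)) (trans cv (sym (pinch-y refl))))))
          (halves y)
      where
      suc≢ : ∀ {x} → pinch i x ≡ j → suc i ≢ x
      suc≢ eq refl = i≢j (trans (sym (pinch-suc i)) eq)

    -- Two disjoint classes, each with more than half of `S`, would together exceed `S`. Two
    -- colourings appear because the classes compared come from different mergers of one colouring.
    at-most-one-large : ∀ {k k′} (c : Fin n → Fin k) (c′ : Fin n → Fin k′) (S : Subset n) i i′ →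
      (∀ v → c v ≡ i → c′ v ≡ i′ → ⊥) → ¬ Halves Y c S i → ¬ Halves Y c′ S i′ → ⊥
    at-most-one-large c c′ S i i′ disjoint large large′ = <-irrefl refl (begin-strict
      ∣ S ∣ + ∣ S ∣ <⟨ +-mono-< (≰⇒> large) (≰⇒> large′) ⟩
      2 * a + 2 * b ≡⟨ *-distribˡ-+ 2 a b ⟨
      2 * (a + b)   ≤⟨ *-monoʳ-≤ 2 (disjoint⇒∣p∣+∣q∣≤∣r∣ (λ v∈ → proj₁ (comprehension⁻ (colourClass? Y c S i) v∈))
                          (λ v∈ → proj₁ (comprehension⁻ (colourClass? Y c′ S i′) v∈))
                          (λ {v} v∈ v∈′ → disjoint v (proj₂ (proj₂ (comprehension⁻ (colourClass? Y c S i) v∈)))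
                             (proj₂ (proj₂ (comprehension⁻ (colourClass? Y c′ S i′) v∈′))))) ⟩
      2 * ∣ S ∣     ≡⟨ cong (∣ S ∣ +_) (+-identityʳ ∣ S ∣) ⟩
      ∣ S ∣ + ∣ S ∣ ∎)
      where
      open ≤-Reasoning
      a = ∣ colourClass Y c S i ∣
      b = ∣ colourClass Y c′ S i′ ∣

    -- The mergers at 0, 2 and 4 join the pairs {0,1}, {2,3} and {4,5}. Three disjoint pairs take
    -- six colours, which is why merging stops at five.
    0-2-disjoint : ∀ {k} (x : Fin (6 + k)) → pinch 0F x ≡ 0F → pinch 2F x ≡ 2F → ⊥
    0-2-disjoint zero          _ ()
    0-2-disjoint (suc zero)    _ ()
    0-2-disjoint (suc (suc x)) ()

    0-4-disjoint : ∀ {k} (x : Fin (6 + k)) → pinch 0F x ≡ 0F → pinch 4F x ≡ 4F → ⊥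
    0-4-disjoint zero          _ ()
    0-4-disjoint (suc zero)    _ ()
    0-4-disjoint (suc (suc x)) ()

    2-4-disjoint : ∀ {k} (x : Fin (6 + k)) → pinch 2F x ≡ 2F → pinch 4F x ≡ 4F → ⊥
    2-4-disjoint 0F _ ()
    2-4-disjoint 1F _ ()
    2-4-disjoint 2F _ ()
    2-4-disjoint 3F _ ()
    2-4-disjoint (suc (suc (suc (suc x)))) ()

  -- Among three disjoint pairs of colours, at most one pair holds more than half of S and at
  -- most one more than half of S′, so some pair can be merged.
  merge-colours : (S S′ : Subset n) → ∀ k (c : Fin n → Fin (5 + k)) →
    (∀ j → Halves Y c S j) → (∀ j → Halves Y c S′ j) →
    Σ (Fin n → Fin 5) λ c′ → (∀ j → Halves Y c′ S j) × (∀ j → Halves Y c′ S′ j) ×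
      (∀ u v → c u ≡ c v → c′ u ≡ c′ v)
  merge-colours S S′ zero    c h h′ = c , h , h′ , λ _ _ eq → eq
  merge-colours S S′ (suc k) c h h′ = find (good? 0F) (good? 2F) (good? 4F)
    where
    Good : Fin (5 + k) → Subset n → Set
    Good i R = Halves Y (pinch i ∘ c) R i
    good? : ∀ i → Good i S × Good i S′ ⊎ (¬ Good i S ⊎ ¬ Good i S′)
    good? i with 2 * ∣ colourClass Y (pinch i ∘ c) S i ∣ ≤? ∣ S ∣ | 2 * ∣ colourClass Y (pinch i ∘ c) S′ i ∣ ≤? ∣ S′ ∣
    ... | yes g | yes g′ = inj₁ (g , g′)
    ... | no ¬g | _      = inj₂ (inj₁ ¬g)
    ... | _     | no ¬g′ = inj₂ (inj₂ ¬g′)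
    Goal : Set
    Goal = Σ (Fin n → Fin 5) λ c′ → (∀ j → Halves Y c′ S j) × (∀ j → Halves Y c′ S′ j) ×
      (∀ u v → c u ≡ c v → c′ u ≡ c′ v)
    recurse : ∀ i → Good i S × Good i S′ → Goal
    recurse i (g , g′) with merge-colours S S′ k (pinch i ∘ c) (pinch-halves c S i h g) (pinch-halves c S′ i h′ g′)
    ... | c′ , H , H′ , coarser = c′ , H , H′ , λ u v eq → coarser u v (cong (pinch i) eq)
    clash : ∀ {i i′} → (∀ x → pinch i x ≡ i → pinch i′ x ≡ i′ → ⊥) → ∀ {R} → ¬ Good i R → ¬ Good i′ R → Goal
    clash {i} {i′} disjoint {R} b b′ =
      contradiction b′ (at-most-one-large (pinch i ∘ c) (pinch i′ ∘ c) R i i′ (disjoint ∘ c) b)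
    Verdict : Fin (5 + k) → Set
    Verdict i = Good i S × Good i S′ ⊎ (¬ Good i S ⊎ ¬ Good i S′)
    find : Verdict 0F → Verdict 2F → Verdict 4F → Goal

    find (inj₁ g) _ _ = recurse 0F g
    find _ (inj₁ g) _ = recurse 2F g
    find _ _ (inj₁ g) = recurse 4F g
    find (inj₂ (inj₁ a)) (inj₂ (inj₁ b)) _ = clash 0-2-disjoint {S} a b
    find (inj₂ (inj₂ a)) (inj₂ (inj₂ b)) _ = clash 0-2-disjoint {S′} a b
    find (inj₂ (inj₁ a)) _ (inj₂ (inj₁ b)) = clash 0-4-disjoint {S} a b
    find (inj₂ (inj₂ a)) _ (inj₂ (inj₂ b)) = clash 0-4-disjoint {S′} a b
    find _ (inj₂ (inj₁ a)) (inj₂ (inj₁ b)) = clash 2-4-disjoint {S} a b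
    find _ (inj₂ (inj₂ a)) (inj₂ (inj₂ b)) = clash 2-4-disjoint {S′} a b

-- Splitting a vertex set together with its neighbourhood

module _ {n} (G : Graph n) where

  Boundary : Subset n → Fin n → Set
  Boundary W u = u ∉ W × ∃ λ v → v ∈ W × adj G u v ≡ true

  boundary? : ∀ W → Decidable (Boundary W)
  boundary? W u = ¬? (u ∈? W) ×-dec Fin.any? (λ v → (v ∈? W) ×-dec (adj G u v Bool.≟ true))

  boundary : Subset n → Subset n
  boundary W = comprehension (boundary? W)

  -- In the instance built by `split`, `blocked` is the separator together with everything outside
  -- `W ∪ N(W)`; unblocked vertices are those of `G[W ∪ N(W)]` that survive the separator.
  record Split (α : Exponent) (K : ℕ) (W : Subset n) : Set where
    field
      separator : Subset n
      blocked   : Subset n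
      colour    : Fin n → Fin 5
      separator-bound   : Bounded α K (∣ W ∪ boundary W ∣) 1 (∣ separator ∣)
      blocked⇒separator : ∀ {v} → v ∈ W ∪ boundary W → v ∈ blocked → v ∈ separator
      colour-edge       : ∀ u v → ComponentEdge G blocked u v → colour u ≡ colour v
      halves            : ∀ j → Halves blocked colour W j
      halves-boundary   : ∀ j → Halves blocked colour (boundary W) j

  split : ∀ {α} {𝒞 : GraphClass} → Hereditary 𝒞 → (s : Separable 𝒞 α) → 𝒞 G → ∀ W →
          Split α (suc (proj₁ s) + suc (proj₁ s)) W
  split {α} her s@(K , _) G∈𝒞 W
    with relative-separator {α} her s G G∈𝒞 (W ∪ boundary W) W (p⊆p∪q _)
       | relative-separator {α} her s G G∈𝒞 (W ∪ boundary W) (boundary W) (q⊆p∪q W _)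
  ... | X , X-bound , X-balanced | X′ , X′-bound , X′-balanced
    with component-labelling G ((X ∪ X′) ∪ ∁ (W ∪ boundary W))
  ... | c , conn , edge = record
    { separator = X ∪ X′
    ; blocked   = Y
    ; colour    = c′
    -- The constants are raised to `suc K` because `Bounded-+` asks for nonzero ones.
    ; separator-bound = Bounded-≤ ≤-refl (∣p∪q∣≤∣p∣+∣q∣ X X′)
        (Bounded-+ (Bounded-≤ (n≤1+n K) ≤-refl X-bound) (Bounded-≤ (n≤1+n K) ≤-refl X′-bound))
    ; blocked⇒separator = λ v∈A v∈Y → [ (λ v∈ → v∈) , (λ v∈ → contradiction v∈A (x∈∁p⇒x∉p v∈)) ]′ (x∈p∪q⁻ _ _ v∈Y)
    ; colour-edge     = λ u v uv → coarser u v (cong (5 ↑ʳ_) (edge u v uv))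
    ; halves          = proj₁ (proj₂ merged)
    ; halves-boundary = proj₁ (proj₂ (proj₂ merged))
    }
    where
    A = W ∪ boundary W
    Y = (X ∪ X′) ∪ ∁ A
    conn′ : ∀ u v → 5 ↑ʳ c u ≡ 5 ↑ʳ c v → Connected G Y u v
    conn′ u v eq = conn u v (Fin.↑ʳ-injective 5 _ _ eq)
    ⊆Y : ∀ {Z} → Z ⊆ X ∪ X′ → Z ∪ ∁ A ⊆ Y
    ⊆Y Z⊆ v∈ = x∈p∪q⁺ ([ inj₁ ∘ Z⊆ , inj₂ ]′ (x∈p∪q⁻ _ _ v∈))
    -- The `n` labels are embedded into `5 + n` colours, so that merging starts with at least five
    -- even for small `n`.
    merged = merge-colours Y W (boundary W) n ((5 ↑ʳ_) ∘ c)
      (connected-classes-halve G X-balanced (⊆Y (p⊆p∪q X′)) ((5 ↑ʳ_) ∘ c) conn′)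
      (connected-classes-halve G X′-balanced (⊆Y (q⊆p∪q X X′)) ((5 ↑ʳ_) ∘ c) conn′)
    c′ = proj₁ merged
    coarser = proj₂ (proj₂ (proj₂ merged))

-- The complete 5-ary tree

-- A node of the complete 5-ary tree with levels 0 … L, as its path from the root.
data Node : ℕ → Set where
  root  : ∀ {L} → Node L
  child : ∀ {L} → Fin 5 → Node L → Node (suc L)

-- Paths are read from the root, so the parent is found by dropping the innermost step.
parentNode : ∀ {L} → Node L → Maybe (Node L)
parentNode root                  = nothing
parentNode (child c root)        = just root
parentNode (child c (child d x)) = Maybe.map (child c) (parentNode (child d x))

level : ∀ {L} → Node L → ℕ
level root        = 0
level (child _ x) = suc (level x)

level≤L : ∀ {L} (x : Node L) → level x ≤ L
level≤L root        = z≤n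
level≤L (child _ x) = s≤s (level≤L x)

infix 4 _⊑_
-- Ancestry as the prefix order on paths. It unfolds from the root, as the placement of vertices
-- does, whereas `Anc` climbs from the descendant.
data _⊑_ : ∀ {L} → Node L → Node L → Set where
  root⊑  : ∀ {L} {x : Node L} → root ⊑ x
  child⊑ : ∀ {L c} {x y : Node L} → x ⊑ y → child c x ⊑ child c y

⊑-refl : ∀ {L} {x : Node L} → x ⊑ x
⊑-refl {x = root}      = root⊑
⊑-refl {x = child c x} = child⊑ ⊑-refl

⊑-trans : ∀ {L} {x y z : Node L} → x ⊑ y → y ⊑ z → x ⊑ z
⊑-trans root⊑      _          = root⊑
⊑-trans (child⊑ p) (child⊑ q) = child⊑ (⊑-trans p q)

data ChildOf : ∀ {L} → Node L → Fin 5 → Node L → Set where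
  top  : ∀ {L c} → ChildOf {suc L} root c (child c root)
  down : ∀ {L c d} {x y : Node L} → ChildOf x c y → ChildOf (child d x) c (child d y)

parentNode⇒childOf : ∀ {L} (y : Node L) {x} → parentNode y ≡ just x → ∃ λ c → ChildOf x c y
parentNode⇒childOf (child c root) refl = c , top
parentNode⇒childOf (child c y@(child d _)) eq with parentNode y in eq′
parentNode⇒childOf (child c y@(child d _)) refl | just x =
  let e , p = parentNode⇒childOf y eq′ in e , down p

child-parentNode : ∀ {L} c (x : Node L) → ∃ λ y → parentNode (child c x) ≡ just y
child-parentNode c root = root , refl
child-parentNode c (child d x) with parentNode (child d x) | child-parentNode d x
... | _ | y , refl = child c y , refl

childOf⇒parentNode : ∀ {L c} {x y : Node L} → ChildOf x c y → parentNode y ≡ just x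
childOf⇒parentNode top              = refl
childOf⇒parentNode (down {y = child _ _} p) rewrite childOf⇒parentNode p = refl

childOf-unique : ∀ {L c} {x y y′ : Node L} → ChildOf x c y → ChildOf x c y′ → y ≡ y′
childOf-unique top      top      = refl
childOf-unique (down p) (down q) = cong (child _) (childOf-unique p q)

childOf⇒level : ∀ {L c} {x y : Node L} → ChildOf x c y → level y ≡ suc (level x)
childOf⇒level top      = refl
childOf⇒level (down p) = cong suc (childOf⇒level p)

childOf⇒⊑ : ∀ {L c} {x y : Node L} → ChildOf x c y → x ⊑ y
childOf⇒⊑ top      = root⊑
childOf⇒⊑ (down p) = child⊑ (childOf⇒⊑ p)

-- Ancestry as a chain of child steps in the shape of `Anc`; it mediates between `⊑` and `Anc`.
data Descends {L} (y : Node L) : Node L → Set where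
  here  : Descends y y
  below : ∀ {x z c} → ChildOf z c x → Descends y z → Descends y x

descends-trans : ∀ {L} {x y z : Node L} → Descends x y → Descends y z → Descends x z
descends-trans p here        = p
descends-trans p (below e q) = below e (descends-trans p q)

descends-child : ∀ {L c} {x y : Node L} → Descends x y → Descends (child c x) (child c y)
descends-child here        = here
descends-child (below e p) = below (down e) (descends-child p)

descends-root : ∀ {L} (x : Node L) → Descends root x
descends-root root        = here
descends-root (child c x) = descends-trans (below top here) (descends-child (descends-root x))

⊑⇒descends : ∀ {L} {x y : Node L} → x ⊑ y → Descends x y
⊑⇒descends root⊑      = descends-root _
⊑⇒descends (child⊑ p) = descends-child (⊑⇒descends p)

size : ℕ → ℕ
size zero    = 1
size (suc L) = suc (5 * size L)

encode : ∀ {L} → Node L → Fin (size L)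
encode {zero}  root        = zero
encode {suc L} root        = zero
encode {suc L} (child c x) = suc (combine c (encode x))

decode : ∀ {L} → Fin (size L) → Node L
decodeChild : ∀ {L} → Fin 5 × Fin (size L) → Node (suc L)
decode {zero}  _       = root
decode {suc L} zero    = root
decode {suc L} (suc i) = decodeChild (remQuot {5} (size L) i)
decodeChild (c , j)    = child c (decode j)

decode-encode : ∀ {L} (x : Node L) → decode (encode x) ≡ x
decode-encode {zero}  root        = refl
decode-encode {suc L} root        = refl
decode-encode {suc L} (child c x) =
  trans (cong decodeChild (Fin.remQuot-combine {5} {size L} c (encode x))) (cong (child c) (decode-encode x))

encode-decode : ∀ {L} (i : Fin (size L)) → encode (decode {L} i) ≡ i
encode-decodeChild : ∀ {L} (cj : Fin 5 × Fin (size L)) →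
                     encode (decodeChild {L} cj) ≡ suc (combine (proj₁ cj) (proj₂ cj))
encode-decode {zero}  zero    = refl
encode-decode {suc L} zero    = refl
encode-decode {suc L} (suc i) =
  trans (encode-decodeChild {L} (remQuot {5} (size L) i)) (cong suc (Fin.combine-remQuot {5} (size L) i))
encode-decodeChild {L} (c , j) = cong (λ j → suc (combine c j)) (encode-decode {L} j)

decode-injective : ∀ {L} {i j : Fin (size L)} → decode {L} i ≡ decode j → i ≡ j
decode-injective {L} {i} {j} eq = trans (sym (encode-decode {L} i)) (trans (cong encode eq) (encode-decode {L} j))

module _ {L : ℕ} where

  private
    parentFin : Fin (size L) → Maybe (Fin (size L))
    parentFin i = Maybe.map encode (parentNode (decode {L} i))

    parentFin⇒childOf : ∀ i {j} → parentFin i ≡ just j → ∃ λ c → ChildOf {L} (decode j) c (decode i)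
    parentFin⇒childOf i eq with parentNode (decode {L} i) in eq′
    parentFin⇒childOf i refl | just x with parentNode⇒childOf (decode {L} i) eq′
    ... | c , p = c , subst (λ z → ChildOf z c (decode i)) (sym (decode-encode x)) p

    parentFin⇒root : ∀ i → parentFin i ≡ nothing → decode {L} i ≡ root
    parentFin⇒root i eq with decode {L} i
    ... | root = refl
    ... | child c x with parentNode (child c x) | child-parentNode c x
    parentFin⇒root i () | child c x | _ | y , refl

  completeForest : RootedForest (size L)
  completeForest .parent = parentFin
  completeForest .depth i = level (decode {L} i)
  completeForest .depth-root i eq = cong level (parentFin⇒root i eq)
  completeForest .depth-parent i j eq = childOf⇒level (proj₂ (parentFin⇒childOf i eq))

  anc⇒⊑ : ∀ {i j} → Anc completeForest i j → decode {L} i ⊑ decode j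
  anc⇒⊑ anc-refl        = ⊑-refl
  anc⇒⊑ (anc-step eq p) = ⊑-trans (anc⇒⊑ p) (childOf⇒⊑ (proj₂ (parentFin⇒childOf _ eq)))

  ⊑⇒anc : ∀ {x y : Node L} → x ⊑ y → Anc completeForest (encode x) (encode y)
  ⊑⇒anc = go ∘ ⊑⇒descends
    where
    go : ∀ {x y} → Descends x y → Anc completeForest (encode x) (encode y)
    go here        = anc-refl
    go (below {x} e p) = anc-step
      (trans (cong (Maybe.map encode ∘ parentNode) (decode-encode x)) (cong (Maybe.map encode) (childOf⇒parentNode e)))
      (go p)

  -- Siblings are told apart by their branch in `Fin 5`, which leaves room below the required seven.
  completeForest-C1 : C1 completeForest
  completeForest-C1 =
    (encode root
      , cong (Maybe.map encode ∘ parentNode) (decode-encode {L} root)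
      , λ i eq → trans (sym (encode-decode {L} i)) (cong encode (parentFin⇒root i eq)))
    , λ i T T-children → ≤-trans
        (injection⇒∣p∣≤∣q∣ {q = ⊤} (λ j c → ChildOf (decode {L} i) c (decode j))
          (λ j j∈T → let c , p = parentFin⇒childOf j (T-children j j∈T) in c , ∈⊤ , p)
          (λ p q → decode-injective {L} (childOf-unique p q)))
        (m≤m+n 5 2)

-- Placing the vertices in the tree

module Elimination {n} (G : Graph n) {α : Exponent} {K : ℕ} (split : ∀ W → Split G α K W) where
  module S W = Split (split W)

  part : Subset n → Fin 5 → Subset n
  part W c = colourClass (S.blocked W) (S.colour W) W c

  part⁻ : ∀ W {c v} → v ∈ part W c → v ∈ W × v ∉ S.blocked W × S.colour W v ≡ c
  part⁻ W {c} = comprehension⁻ (colourClass? (S.blocked W) (S.colour W) W c)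

  part⁺ : ∀ W {c v} → v ∈ W → v ∉ S.blocked W → S.colour W v ≡ c → v ∈ part W c
  part⁺ W {c} v∈W v∉ eq = comprehension⁺ (colourClass? (S.blocked W) (S.colour W) W c) (v∈W , v∉ , eq)

  blocked∩W⇒separator : ∀ W {v} → v ∈ W → v ∈ S.blocked W → v ∈ S.separator W
  blocked∩W⇒separator W v∈W = S.blocked⇒separator W (x∈p∪q⁺ (inj₁ v∈W))

  -- A vertex stops at the first node whose blocked set contains it. With no levels left, all
  -- remaining vertices share the leaf; `leaf-≤1` will show that at most one remains.
  place : ∀ L → Subset n → Fin n → Node L
  place zero    W v = root
  place (suc L) W v with v ∈? S.blocked W
  ... | yes _ = root
  ... | no  _ = child (S.colour W v) (place L (part W (S.colour W v)) v)

  -- The vertex set handed down to a node. By `⊑place⇒region` and `region⇒⊑place` it is the preimage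
  -- of the node's subtree under `place`.
  region : ∀ {L} → Node L → Subset n → Subset n
  region root        W = W
  region (child c x) W = region x (part W c)

  region-⊆ : ∀ {L} (x : Node L) W → region x W ⊆ W
  region-⊆ root        W v∈ = v∈
  region-⊆ (child c x) W v∈ = proj₁ (part⁻ W (region-⊆ x (part W c) v∈))

  ⊑place⇒region : ∀ {L} {x : Node L} {W v} → v ∈ W → x ⊑ place L W v → v ∈ region x W
  ⊑place⇒region {x = root} v∈W _ = v∈W
  ⊑place⇒region {suc L} {child c x} {W} {v} v∈W le with v ∈? S.blocked W
  ⊑place⇒region {suc L} {child c x} {W} {v} v∈W (child⊑ le) | no v∉ =
    ⊑place⇒region (part⁺ W v∈W v∉ refl) le

  region⇒⊑place : ∀ {L} {x : Node L} {W v} → v ∈ region x W → x ⊑ place L W v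
  region⇒⊑place {x = root} _ = root⊑
  region⇒⊑place {suc L} {child c x} {W} {v} v∈ with part⁻ W (region-⊆ x (part W c) v∈)
  ... | v∈W , v∉ , eq with v ∈? S.blocked W
  ... | yes v∈B = contradiction v∈B v∉
  ... | no _ rewrite eq = child⊑ (region⇒⊑place v∈)

  -- A blocked end is placed at the current root, hence is comparable with everything. If neither
  -- end is blocked, both have one colour and the recursion enters the same part.
  place-edge : ∀ L W u v → u ∈ W → v ∈ W → adj G u v ≡ true →
               place L W u ⊑ place L W v ⊎ place L W v ⊑ place L W u
  place-edge zero    W u v u∈W v∈W uv = inj₁ root⊑
  place-edge (suc L) W u v u∈W v∈W uv with u ∈? S.blocked W | v ∈? S.blocked W
  ... | yes _  | _     = inj₁ root⊑
  ... | no _   | yes _ = inj₂ root⊑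
  ... | no u∉ | no v∉ with S.colour W u | S.colour-edge W u v (u∉ , v∉ , uv) | part⁺ W u∈W u∉ refl
  ... | _ | refl | u∈ = Sum.map child⊑ child⊑ (place-edge L _ u v u∈ (part⁺ W v∈W v∉ refl) uv)

  -- A neighbour of the part lies in `W ∪ N(W)`. If blocked, it is in the separator. If not, it has
  -- colour `c`, so it is outside `W`, as otherwise it would belong to the part, and lies in a
  -- halved colour class of `N(W)`.
  boundary-part : ∀ W c → 2 * ∣ boundary G (part W c) ∣ ≤ 2 * ∣ S.separator W ∣ + ∣ boundary G W ∣
  boundary-part W c = begin
    2 * ∣ boundary G (part W c) ∣              ≤⟨ *-monoʳ-≤ 2 (p⊆q⇒∣p∣≤∣q∣ incl) ⟩
    2 * ∣ S.separator W ∪ class ∣              ≤⟨ *-monoʳ-≤ 2 (∣p∪q∣≤∣p∣+∣q∣ (S.separator W) class) ⟩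
    2 * (∣ S.separator W ∣ + ∣ class ∣)        ≡⟨ *-distribˡ-+ 2 (∣ S.separator W ∣) _ ⟩
    2 * ∣ S.separator W ∣ + 2 * ∣ class ∣      ≤⟨ +-monoʳ-≤ (2 * ∣ S.separator W ∣) (S.halves-boundary W c) ⟩
    2 * ∣ S.separator W ∣ + ∣ boundary G W ∣   ∎
    where
    open ≤-Reasoning
    class = colourClass (S.blocked W) (S.colour W) (boundary G W) c
    incl : boundary G (part W c) ⊆ S.separator W ∪ class
    incl {u} u∈ with comprehension⁻ (boundary? G (part W c)) u∈
    ... | u∉part , v , v∈part , uv with part⁻ W v∈part | u ∈? S.blocked W | u ∈? W
    ... | v∈W , v∉ , eq | yes u∈B | yes u∈W = x∈p∪q⁺ (inj₁ (blocked∩W⇒separator W u∈W u∈B))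
    ... | v∈W , v∉ , eq | yes u∈B | no u∉W =
      x∈p∪q⁺ (inj₁ (S.blocked⇒separator W
        (x∈p∪q⁺ (inj₂ (comprehension⁺ (boundary? G W) (u∉W , v , v∈W , uv)))) u∈B))
    ... | v∈W , v∉ , eq | no u∉ | yes u∈W =
      contradiction (part⁺ W u∈W u∉ (trans (S.colour-edge W u v (u∉ , v∉ , uv)) eq)) u∉part
    ... | v∈W , v∉ , eq | no u∉ | no u∉W =
      x∈p∪q⁺ (inj₂ (comprehension⁺ (colourClass? (S.blocked W) (S.colour W) (boundary G W) c)
        (comprehension⁺ (boundary? G W) (u∉W , v , v∈W , uv) , u∉ , trans (S.colour-edge W u v (u∉ , v∉ , uv)) eq)))

-- Size estimates

-- Exponents beyond `s / (1 + s)` follow from `s / (1 + s)` itself because `n / d ≥ 1`, so only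
-- those between α and `s / (1 + s)` have to be examined.
Bounded-near : ∀ {α s K n d x} → Above α s s → d ≤ n →
  (∀ {p q} → Above α p q → p * suc s ≤ s * suc q → PowBound p (suc q) K n d x) → Bounded α K n d x
Bounded-near {α} {s} {K} {n} {d} {x} s-above d≤n near = bounded λ {p} {q} above → go p q above
  where
  go : ∀ p q → Above α p q → PowBound p (suc q) K n d x
  go p q above with ≤-total (p * suc s) (s * suc q)
  ... | inj₁ le = near above le
  ... | inj₂ ge = PowBound-exponent d≤n ge (near s-above ≤-refl)

-- The exponent 1, encoded as the pair `(1, 0)`, lies above α because `s / (1 + s)` does.
Bounded-1⇒linear : ∀ {α s K n d x} → Above α s s → Bounded α K n d x → x * d ≤ K * n
Bounded-1⇒linear {α} {s} {K} {n} {d} {x} s-above h = subst₂ _≤_ (eq x d) (eq K n)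
  (PowBound.inequality (at h (up-closed α {p′ = 1} {q′ = 0} s-above
    (subst₂ _≤_ (sym (*-identityʳ s)) (sym (*-identityˡ (suc s))) (n≤1+n s)))))
  where
  eq : ∀ a b → a ^ 1 * b ^ 1 ≡ a * b
  eq a b = cong₂ _*_ (^-identityʳ a) (^-identityʳ b)

-- s / (1 + s) lies above α, and 1 / t below it.
module Constants (α : Exponent) (s : ℕ) (s-above : Above α s s)
                 (t : ℕ) .{{_ : NonZero t}} (t-below : ∀ {p q} → Above α p q → suc q ≤ p * t)
                 (K : ℕ) .{{K≢0 : NonZero K}} where

  -- M is chosen so that a set W of m vertices with |N(W)| ≤ C m^α has |W ∪ N(W)| ≤ M^(1+s) m,
  -- whence a separator of at most K M^s m^α = D m^α vertices.
  r M D C H : ℕ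
  r = suc s + suc s
  M = suc (r * (2 * K))
  D = K * M ^ s
  C = r * (2 * D)
  H = suc (t + t) * D

  instance
    D≢0 : NonZero D
    D≢0 = m*n≢0 K (M ^ s) {{K≢0}} {{m^n≢0 M s}}

  1+C≤M^[1+s] : suc C ≤ M ^ suc s
  1+C≤M^[1+s] = begin
    1 + r * (2 * (K * M ^ s))        ≤⟨ +-monoˡ-≤ _ (m^n>0 M s) ⟩
    M ^ s + r * (2 * (K * M ^ s))    ≡⟨ eq (M ^ s) r K ⟩
    M * M ^ s                        ∎
    where
    open ≤-Reasoning
    eq : ∀ m r k → m + r * (2 * (k * m)) ≡ suc (r * (2 * k)) * m
    eq = solve-∀

  module Forest {n} {G : Graph n} (split : ∀ W → Split G α K W) (2^ℓ≤n : 2 ^ ⌊log₂ n ⌋ ≤ n) where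
    open Elimination G split

    ℓ = ⌊log₂ n ⌋

    record Small (i : ℕ) (W : Subset n) : Set where
      constructor small
      field
        size-bound     : ∣ W ∣ * 2 ^ i ≤ n
        boundary-bound : Bounded α C n (2 ^ i) (∣ boundary G W ∣)
    open Small

    2^i≤n : ∀ i L → i + L ≡ ℓ → 2 ^ i ≤ n
    2^i≤n i L eq = ≤-trans (^-monoʳ-≤ 2 (subst (i ≤_) eq (m≤m+n i L))) 2^ℓ≤n

    separator-small : ∀ i L → i + L ≡ ℓ → ∀ {W} → Small i W → Bounded α D n (2 ^ i) (∣ S.separator W ∣)
    separator-small i L eq {W} sm = Bounded-near s-above (2^i≤n i L eq) λ above le →
      PowBound-rescale {M = M} {s = s} le size-A (at (S.separator-bound W) above)
      where
      open ≤-Reasoning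
      N = boundary G W
      size-A : ∣ W ∪ N ∣ * 2 ^ i ≤ M ^ suc s * n
      size-A = begin
        ∣ W ∪ N ∣ * 2 ^ i                  ≤⟨ *-monoˡ-≤ (2 ^ i) (∣p∪q∣≤∣p∣+∣q∣ W N) ⟩
        (∣ W ∣ + ∣ N ∣) * 2 ^ i            ≡⟨ *-distribʳ-+ (2 ^ i) (∣ W ∣) (∣ N ∣) ⟩
        ∣ W ∣ * 2 ^ i + ∣ N ∣ * 2 ^ i      ≤⟨ +-mono-≤ (size-bound sm) (Bounded-1⇒linear s-above (boundary-bound sm)) ⟩
        suc C * n                          ≤⟨ *-monoˡ-≤ n 1+C≤M^[1+s] ⟩
        M ^ suc s * n                      ∎

    part-small : ∀ i L → i + suc L ≡ ℓ → ∀ {W} → Small i W → ∀ c → Small (suc i) (part W c)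
    part-small i L eq {W} sm c = small
      (begin
        ∣ part W c ∣ * (2 * 2 ^ i) ≡⟨ rearrange (∣ part W c ∣) (2 ^ i) ⟩
        2 * ∣ part W c ∣ * 2 ^ i   ≤⟨ *-monoˡ-≤ (2 ^ i) (S.halves W c) ⟩
        ∣ W ∣ * 2 ^ i              ≤⟨ size-bound sm ⟩
        n                          ∎)
      (Bounded-near s-above (2^i≤n (suc i) L (trans (sym (+-suc i L)) eq)) λ {p} {q} above le →
        -- By definition `2 * D + C` is `suc r * (2 * D)`, so the gain `1 + 1/r` returns exactly
        -- `C = r * (2 * D)`. The side condition restates `p / (1 + q) ≤ s / (1 + s)`.
        PowBound-halve (suc s)
          (subst (p * suc s + suc q ≤_) (trans (+-comm (s * suc q) (suc q)) (*-comm (suc s) (suc q)))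
             (+-monoˡ-≤ (suc q) le))
          (PowBound-≤ ≤-refl (boundary-part W c)
            (PowBound-+ {a = 2 * D} {b = C} {{m*n≢0 2 D}} {{m*n≢0 r (2 * D) {{_}} {{m*n≢0 2 D}}}}
              (PowBound-*ˡ 2 (at (separator-small i (suc L) eq sm) above))
              (at (boundary-bound sm) above))))
      where
      open ≤-Reasoning
      rearrange : ∀ a b → a * (2 * b) ≡ 2 * a * b
      rearrange = solve-∀

    region-small : ∀ i L → i + L ≡ ℓ → ∀ {W} → Small i W → (x : Node L) → Small (i + level x) (region x W)
    region-small i L eq {W} sm root = subst (λ j → Small j W) (sym (+-identityʳ i)) sm
    region-small i (suc L) eq {W} sm (child c x) = subst (λ j → Small j (region x (part W c))) (sym (+-suc i (level x)))
      (region-small (suc i) L (trans (sym (+-suc i L)) eq) (part-small i L eq sm c) x)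

    -- From `n < 2 ^ (1 + ℓ)` one gets `∣ W ∣ < 2`; hence the recursion may stop at level `ℓ`
    -- without a separator.
    leaf-≤1 : ∀ {W} → Small ℓ W → ∣ W ∣ ≤ 1
    leaf-≤1 {W} sm = s≤s⁻¹ (*-cancelʳ-< (2 ^ ℓ) (∣ W ∣) 2 (≤-<-trans (size-bound sm) (n<2^[1+⌊log₂n⌋] n)))

    root-bag-bounded : ∀ i L → i + L ≡ ℓ → ∀ {W} → Small i W → ∀ T → T ⊆ W →
      (∀ v → v ∈ T → place L W v ⊑ root) → Bounded α D n (2 ^ i) (∣ T ∣)
    root-bag-bounded i zero eq {W} sm T T⊆W T-bag = bounded λ _ →
      PowBound-1 (>-nonZero⁻¹ D) (2^i≤n i 0 eq)
        (≤-trans (p⊆q⇒∣p∣≤∣q∣ T⊆W) (leaf-≤1 (subst (λ j → Small j W) (trans (sym (+-identityʳ i)) eq) sm)))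
    root-bag-bounded i (suc L) eq {W} sm T T⊆W T-bag =
      Bounded-≤ ≤-refl (p⊆q⇒∣p∣≤∣q∣ incl) (separator-small i (suc L) eq sm)
      where
      incl : T ⊆ S.separator W
      incl {v} v∈T with v ∈? S.blocked W | T-bag v v∈T
      ... | yes v∈B | _ = blocked∩W⇒separator W (T⊆W v∈T) v∈B

    bag-bounded : ∀ i L → i + L ≡ ℓ → ∀ {W} → Small i W → (x : Node L) → ∀ T → T ⊆ W →
      (∀ v → v ∈ T → place L W v ≡ x) → Bounded α D n (2 ^ (i + level x)) (∣ T ∣)
    bag-bounded i L eq sm root T T⊆W T-bag =
      subst (λ j → Bounded α D n (2 ^ j) (∣ T ∣)) (sym (+-identityʳ i))
        (root-bag-bounded i L eq sm T T⊆W λ v v∈T → subst (_⊑ root) (sym (T-bag v v∈T)) root⊑)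
    bag-bounded i (suc L) eq {W} sm (child c x) T T⊆W T-bag =
      subst (λ j → Bounded α D n (2 ^ j) (∣ T ∣)) (sym (+-suc i (level x)))
        (bag-bounded (suc i) L (trans (sym (+-suc i L)) eq) (part-small i L eq sm c) x T
          (λ {v} v∈T → proj₁ (inner v v∈T)) (λ v v∈T → proj₂ (inner v v∈T)))
      where
      inner : ∀ v → v ∈ T → v ∈ part W c × place L (part W c) v ≡ x
      inner v v∈T with v ∈? S.blocked W | T-bag v v∈T
      ... | no v∉ | refl = part⁺ W (T⊆W v∈T) v∉ refl , refl

    -- Write `m = n / 2^i`. The top bag has at most `D m^α` vertices; the rest lies in one part,
    -- where the bound `H (m/2)^α` is at most `2t D m^α`. Since `H = D + 2t D`, the bound reproduces
    -- itself.
    path-bounded : ∀ i L → i + L ≡ ℓ → ∀ {W} → Small i W → (x : Node L) → ∀ T → T ⊆ W →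
      (∀ v → v ∈ T → place L W v ⊑ x) → Bounded α H n (2 ^ i) (∣ T ∣)
    path-bounded i L eq sm root T T⊆W T-path =
      Bounded-≤ (m≤m+n D _) ≤-refl (root-bag-bounded i L eq sm T T⊆W T-path)
    path-bounded i (suc L) eq {W} sm (child c x) T T⊆W T-path =
      bounded λ above → PowBound-≤ ≤-refl (≤-trans (p⊆q⇒∣p∣≤∣q∣ incl) (∣p∪q∣≤∣p∣+∣q∣ (S.separator W) (T ∩ part W c)))
        (PowBound-+ {{D≢0}} {{m*n≢0 (t + t) D {{t+t≢0}}}} (at (separator-small i (suc L) eq sm) above)
          (PowBound-double t (t-below above) (at rest above)))
      where
      t+t≢0 : NonZero (t + t)
      t+t≢0 = >-nonZero (≤-trans (>-nonZero⁻¹ t) (m≤m+n t t))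
      inner : ∀ v → v ∈ part W c → v ∈ T → place L (part W c) v ⊑ x
      inner v v∈p v∈T with part⁻ W v∈p
      ... | _ , v∉ , eq with v ∈? S.blocked W | T-path v v∈T
      ... | yes v∈ | _ = contradiction v∈ v∉
      ... | no _ | child⊑ le = le
      rest : Bounded α H n (2 ^ suc i) (∣ T ∩ part W c ∣)
      rest = path-bounded (suc i) L (trans (sym (+-suc i L)) eq) (part-small i L eq sm c) x (T ∩ part W c)
        (λ v∈ → proj₂ (x∈p∩q⁻ T _ v∈))
        (λ v v∈ → let v∈T , v∈p = x∈p∩q⁻ T _ v∈ in inner v v∈p v∈T)
      incl : T ⊆ S.separator W ∪ (T ∩ part W c)
      incl {v} v∈T with v ∈? S.blocked W | T-path v v∈T
      ... | yes v∈B | _ = x∈p∪q⁺ (inj₁ (blocked∩W⇒separator W (T⊆W v∈T) v∈B))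
      ... | no v∉ | child⊑ _ = x∈p∪q⁺ (inj₂ (x∈p∩q⁺ (v∈T , part⁺ W (T⊆W v∈T) v∉ refl)))

    forest : RootedForest (size ℓ)
    forest = completeForest {ℓ}

    η : Fin n → Fin (size ℓ)
    η v = encode (place ℓ ⊤ v)

    ⊤-small : Small 0 ⊤
    ⊤-small = small (≤-reflexive (trans (*-identityʳ _) (∣⊤∣≡n n)))
      (bounded λ {p} {q} _ → powBound (subst (λ z → z ^ suc q * 1 ^ p ≤ C ^ suc q * n ^ p) (sym ∣N∣≡0) z≤n))
      where
      ∣N∣≡0 : ∣ boundary G ⊤ ∣ ≡ 0
      ∣N∣≡0 = trans (cong ∣_∣ (Empty-unique λ (u , u∈) →
        proj₁ (comprehension⁻ (boundary? G ⊤) u∈) ∈⊤)) (∣⊥∣≡0 n)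

    η⁻ : ∀ {x} v → Anc forest x (η v) → decode {ℓ} x ⊑ place ℓ ⊤ v
    η⁻ {x} v anc = subst (decode {ℓ} x ⊑_) (decode-encode (place ℓ ⊤ v)) (anc⇒⊑ {ℓ} anc)

    η⁺ : ∀ {x} v → decode {ℓ} x ⊑ place ℓ ⊤ v → Anc forest x (η v)
    η⁺ {x} v le = subst (λ y → Anc forest y (η v)) (encode-decode {ℓ} x) (⊑⇒anc le)

    forest-elim : IsGenElimForest G forest η
    forest-elim u v uv = Sum.map ⊑⇒anc ⊑⇒anc (place-edge ℓ ⊤ u v ∈⊤ ∈⊤ uv)

    forest-C2 : C2 α (C + H) G forest η
    forest-C2 =
      (λ x → level≤L (decode {ℓ} x)) ,
      (λ x T T-path → Bounded⇒BoundedBy {α} (Bounded-≤ (m≤n+m H C) ≤-refl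
        (path-bounded 0 ℓ refl ⊤-small (decode {ℓ} x) T ⊆⊤ λ v v∈T →
          subst (_⊑ decode {ℓ} x) (decode-encode (place ℓ ⊤ v)) (anc⇒⊑ {ℓ} (T-path v v∈T)))))

    forest-C3 : C3 α (C + H) G forest η
    forest-C3 x =
      (λ T T-bag → Bounded⇒BoundedBy {α} (Bounded-≤ (≤-trans (m≤m+n D _) (m≤n+m H C)) ≤-refl
        (bag-bounded 0 ℓ refl ⊤-small y T ⊆⊤ λ v v∈T →
          trans (sym (decode-encode (place ℓ ⊤ v))) (cong decode (T-bag v v∈T))))) ,
      (λ T T-sub → ≤-trans
        (*-monoˡ-≤ (2 ^ level y) (p⊆q⇒∣p∣≤∣q∣ λ {v} v∈T → ⊑place⇒region ∈⊤ (η⁻ v (T-sub v v∈T))))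
        (size-bound y-small)) ,
      (λ T T-bd → Bounded⇒BoundedBy {α} (Bounded-≤ (m≤m+n C H) (p⊆q⇒∣p∣≤∣q∣ λ {w} w∈T →
          let w⋢ , v , v⊒ , wv = T-bd w w∈T in
          comprehension⁺ (boundary? G (region y ⊤))
            ((λ w∈ → w⋢ (η⁺ w (region⇒⊑place w∈))) , v , ⊑place⇒region ∈⊤ (η⁻ v v⊒) , wv))
        (boundary-bound y-small)))
      where
      y = decode {ℓ} x
      y-small : Small (level y) (region y ⊤)
      y-small = region-small 0 ℓ refl ⊤-small y

theorem4p4 : (α : Exponent) (𝒞 : GraphClass) → Hereditary 𝒞 → Separable 𝒞 α →
    Σ ℕ λ K → ∀ {n} (G : Graph n) → 𝒞 G →
    Σ ℕ λ m → Σ (RootedForest m) λ F → Σ (Fin n → Fin m) λ η →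
    IsGenElimForest G F η × C1 F × C2 α K G F η × C3 α K G F η
theorem4p4 α 𝒞 her sep@(K , _) with below-one α | positive α
... | s₁ , s , s₁-above , s₁≤s | suc p , q , _ , ¬above = Cs.C + Cs.H , forests
  where
  -- `below-one` gives `s₁ / (1 + s)` above α with `s₁ ≤ s`; enlarging the numerator to `s` still
  -- stays below one.
  s-above : Above α s s
  s-above = up-closed α s₁-above (*-monoˡ-≤ (suc s) (s≤s⁻¹ s₁≤s))
  -- `positive` gives `(1 + p) / (1 + q)` not above α. Every exponent above α exceeds it, hence is
  -- at least `1 / (1 + q)`, and `t` becomes `suc q`.
  t-below : ∀ {p′ q′} → Above α p′ q′ → suc q′ ≤ p′ * suc q
  t-below {p′} {q′} above with ≤-total (p′ * suc q) (suc p * suc q′)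
  ... | inj₁ le = contradiction (up-closed α above le) ¬above
  ... | inj₂ ge = ≤-trans (m≤m+n (suc q′) (p * suc q′)) ge
  module Cs = Constants α s s-above (suc q) t-below (suc K + suc K)
  forests : ∀ {n} (G : Graph n) → 𝒞 G →
    Σ ℕ λ m → Σ (RootedForest m) λ F → Σ (Fin n → Fin m) λ η →
    IsGenElimForest G F η × C1 F × C2 α (Cs.C + Cs.H) G F η × C3 α (Cs.C + Cs.H) G F η
  -- For `n = 0` the inequality `2 ^ ⌊log₂ n ⌋ ≤ n` fails, so a single node with an empty bag is
  -- used.
  forests {zero} G G∈𝒞 = 1 , completeForest {0} , (λ ()) , (λ ()) , completeForest-C1 {0} ,
    ((λ _ → z≤n) , λ { _ [] _ _ _ _ → z≤n }) ,
    λ _ → (λ { [] _ _ _ _ → z≤n }) , (λ { [] _ → z≤n }) , λ { [] _ _ _ _ → z≤n }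
  forests {suc n} G G∈𝒞 = size ⌊log₂ suc n ⌋ , forest , η , forest-elim , completeForest-C1 , forest-C2 , forest-C3
    where open Cs.Forest (split G her sep G∈𝒞) (2^⌊log₂n⌋≤n n)
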